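{- There is an algorithm which, given a single-row ($1\times M$) edge-matching puzzle with the free border rule in which the only allowed manipulation is in-place rotation of the pieces, produces a solution of the puzzle or determines that the puzzle is unsolvable, in time linear in the number $M$ of pieces.
   Context: A piece is a unit square whose four edges are colored; it is given by a tuple $(c_r,c_t,c_l,c_b)$ of the colors on its right, top, left and bottom edges, in this (counter-clockwise) order. A $1\times M$ puzzle consists of a board with one row and $M$ cells, together with $M$ pieces $p_0,\dots,p_{M-1}$ placed in the cells from left to right, one per cell. In-place rotation means that each piece stays in its cell and may be rotated independently counter-clockwise by $0^\circ$, $90^\circ$, $180^\circ$ or $270^\circ$ (i.e. its color tuple is cyclically shifted); no swapping of positions is allowed. Two pieces in adjacent cells match if the two touching edges have the same color. The board is solved if all pairs of neighboring pieces match. Free border rule: edges facing the border of the board (in particular all top and bottom edges, the left edge of the leftmost piece and the right edge of the rightmost piece) are unrestricted. A solution is an arrangement, reachable by the allowed manipulations, in which the board is solved. Colors can be compared in constant time. -}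

module Defs where

open import Data.Bool using (Bool; true; false; if_then_else_)
open import Data.Fin using (Fin; toℕ; fromℕ<)
open import Data.Maybe using (Maybe; just; nothing)
open import Data.Nat using (ℕ; zero; suc; pred; _+_; _*_; _≤_; _<?_; _≡ᵇ_)
open import Data.Product using (∃; ∃-syntax; _×_; _,_)
open import Data.Sum using (_⊎_)
open import Data.Vec.Functional using (Vector)
open import Relation.Binary.Definitions using (DecidableEquality)
open import Relation.Binary.PropositionalEquality using (_≡_)
open import Relation.Nullary using (¬_; does; yes; no)

data Side : Set where
  right top left bottom : Side

record Piece (Color : Set) : Set where
  constructor ⟨_,_,_,_⟩
  field
    c-right c-top c-left c-bottom : Color

open Piece public

edge : ∀ {Color} → Side → Piece Color → Color
edge right  = c-right
edge top    = c-top
edge left   = c-left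
edge bottom = c-bottom

-- A counter-clockwise quarter turn carries the right edge to the top, the top
-- edge to the left, the left edge to the bottom and the bottom edge to the
-- right.
quarterTurn : ∀ {Color} → Piece Color → Piece Color
quarterTurn ⟨ r , t , l , b ⟩ = ⟨ b , r , t , l ⟩

quarterTurns : ∀ {Color} → ℕ → Piece Color → Piece Color
quarterTurns zero    p = p
quarterTurns (suc k) p = quarterTurn (quarterTurns k p)

-- k stands for a counter-clockwise rotation by k · 90°.
Rotation : Set
Rotation = Fin 4

rotate : ∀ {Color} → Rotation → Piece Color → Piece Color
rotate k = quarterTurns (toℕ k)

-- The pieces on a 1 × M board, from left to right; used both for the given
-- puzzle and for the arrangements obtained from it.
Board : Set → ℕ → Set
Board Color M = Vector (Piece Color) M

rotateInPlace : ∀ {Color M} → Vector Rotation M → Board Color M → Board Color M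
rotateInPlace ρ P i = rotate (ρ i) (P i)

Reachable : ∀ {Color M} → Board Color M → Board Color M → Set
Reachable P A = ∃[ ρ ] (∀ i → A i ≡ rotateInPlace ρ P i)

-- Free border rule: only edges between neighbouring cells are constrained.
Solved : ∀ {Color M} → Board Color M → Set
Solved {M = M} A =
  ∀ (i j : Fin M) → toℕ j ≡ suc (toℕ i) → c-right (A i) ≡ c-left (A j)

IsSolution : ∀ {Color M} → Board Color M → Board Color M → Set
IsSolution P A = Reachable P A × Solved A

Unsolvable : ∀ {Color M} → Board Color M → Set
Unsolvable P = ¬ ∃ (IsSolution P)

-- Algorithms are while-programs on a random access machine with unit cost per
-- operation.  A program uses finitely many scalar variables and arrays, named
-- by literals occurring in its text.  Arithmetic is restricted to successor and
-- predecessor, so every value held after t steps is at most the input size plus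
-- t plus a constant depending on the program; unit cost therefore hides no
-- long-number arithmetic.  Colors are opaque: the pieces form a read-only
-- input, and a color can only be compared with another one.
Var Arr : Set
Var = ℕ
Arr = ℕ

data Test : Set where
  isZero    : Var → Test
  isEqual   : Var → Var → Test
  -- sameColor x s y s′: do side s of piece number x and side s′ of piece
  -- number y, both in their given (unrotated) position, have the same color?
  sameColor : Var → Side → Var → Side → Test

infix  6 _≔const_ _≔_ _≔_at_ _at_≔_
infixr 5 _⨾_

data Program : Set where
  skip              : Program
  _≔const_          : Var → ℕ → Program
  _≔_               : Var → Var → Program
  increment         : Var → Program
  decrement         : Var → Program
  _≔_at_            : Var → Arr → Var → Program
  _at_≔_            : Arr → Var → Var → Program
  _⨾_               : Program → Program → Program
  ifTest_then_else_ : Test → Program → Program → Program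
  while_loop_       : Test → Program → Program

record State : Set where
  constructor state
  field
    var : Var → ℕ
    arr : Arr → ℕ → ℕ

open State public

update : ∀ {A : Set} → (ℕ → A) → ℕ → A → ℕ → A
update f x v y = if y ≡ᵇ x then v else f y

setVar : Var → ℕ → State → State
setVar x v s = state (update (var s) x v) (arr s)

setArr : Arr → ℕ → ℕ → State → State
setArr a n v s = state (var s) (update (arr s) a (update (arr s a) n v))

module Semantics {Color : Set} (_≟_ : DecidableEquality Color)
                 {M : ℕ} (P : Board Color M) where

  readEdge : ℕ → Side → Maybe Color
  readEdge n σ with n <? M
  ... | yes n<M = just (edge σ (P (fromℕ< n<M)))
  ... | no  _   = nothing

  -- A comparison involving a nonexistent piece fails.
  compareColors : Maybe Color → Maybe Color → Bool
  compareColors (just c) (just d) = does (c ≟ d)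
  compareColors _        _        = false

  eval : Test → State → Bool
  eval (isZero x)            s = var s x ≡ᵇ 0
  eval (isEqual x y)         s = var s x ≡ᵇ var s y
  eval (sameColor x σ y τ)   s =
    compareColors (readEdge (var s x) σ) (readEdge (var s y) τ)

  infix 4 _,_⇓_inTime_

  -- p , s ⇓ s′ inTime t: started in s, the program p halts in s′ after exactly
  -- t steps, each elementary command and each evaluation of a test being one
  -- step.
  data _,_⇓_inTime_ : Program → State → State → ℕ → Set where
    ⇓skip      : ∀ {s} → skip , s ⇓ s inTime 1
    ⇓const     : ∀ {s x n} → x ≔const n , s ⇓ setVar x n s inTime 1
    ⇓copy      : ∀ {s x y} → x ≔ y , s ⇓ setVar x (var s y) s inTime 1
    ⇓increment : ∀ {s x} → increment x , s ⇓ setVar x (suc (var s x)) s inTime 1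
    ⇓decrement : ∀ {s x} → decrement x , s ⇓ setVar x (pred (var s x)) s inTime 1
    ⇓load      : ∀ {s x a y} →
                 x ≔ a at y , s ⇓ setVar x (arr s a (var s y)) s inTime 1
    ⇓store     : ∀ {s a x y} →
                 a at x ≔ y , s ⇓ setArr a (var s x) (var s y) s inTime 1
    ⇓seq       : ∀ {p q s s′ s″ t u} →
                 p , s ⇓ s′ inTime t → q , s′ ⇓ s″ inTime u →
                 p ⨾ q , s ⇓ s″ inTime (t + u)
    ⇓then      : ∀ {b p q s s′ t} → eval b s ≡ true →
                 p , s ⇓ s′ inTime t →
                 ifTest b then p else q , s ⇓ s′ inTime suc t
    ⇓else      : ∀ {b p q s s′ t} → eval b s ≡ false →
                 q , s ⇓ s′ inTime t →
                 ifTest b then p else q , s ⇓ s′ inTime suc t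
    ⇓exit      : ∀ {b p s} → eval b s ≡ false →
                 while b loop p , s ⇓ s inTime 1
    ⇓iterate   : ∀ {b p s s′ s″ t u} → eval b s ≡ true →
                 p , s ⇓ s′ inTime t → while b loop p , s′ ⇓ s″ inTime u →
                 while b loop p , s ⇓ s″ inTime suc (t + u)

-- The machine starts with the number of pieces in sizeVar and zeros elsewhere.
-- It must end with 0 in verdictVar for "unsolvable", or with 1 there and the
-- rotation of piece i (in quarter turns) in cell i of outputArr.
sizeVar verdictVar : Var
sizeVar    = 0
verdictVar = 1

outputArr : Arr
outputArr = 0

initial : ℕ → State
initial M = setVar sizeVar M (state (λ _ → 0) (λ _ _ → 0))

ReportsRotations : ∀ {M} → State → Vector Rotation M → Set
ReportsRotations s ρ =
  var s verdictVar ≡ 1 × (∀ i → arr s outputArr (toℕ i) ≡ toℕ (ρ i))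

ReportsUnsolvable : State → Set
ReportsUnsolvable s = var s verdictVar ≡ 0

CorrectOutput : ∀ {Color M} → Board Color M → State → Set
CorrectOutput P s =
    (∃[ ρ ] (ReportsRotations s ρ × IsSolution P (rotateInPlace ρ P)))
  ⊎ (ReportsUnsolvable s × Unsolvable P)

-- One program for all color types, board lengths and puzzles.
SolvesInTime : Program → (ℕ → ℕ) → Set₁
SolvesInTime p T =
  ∀ {Color : Set} (_≟_ : DecidableEquality Color) (M : ℕ) (P : Board Color M) →
  let open Semantics _≟_ P using (_,_⇓_inTime_) in
  ∃[ s ] ∃[ t ] (p , initial M ⇓ s inTime t × t ≤ T M × CorrectOutput P s)

{-# OPTIONS --safe #-}

-- Dynamic programming from left to right: for every cell n and rotation k,
-- decide whether the cells 0 … n have a solved arrangement with cell n rotated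
-- by k, and remember a rotation of cell n - 1 that witnesses it.  The puzzle is
-- solvable iff some rotation of the last cell is attainable, and then following
-- the remembered rotations from right to left yields a solution.  There are
-- four rotations, so each cell costs a bounded number of steps.
module Submission where

open import Data.Bool using (Bool; true; false)
open import Data.Bool.Properties using (T-≡; ¬-not)
open import Data.Empty using (⊥)
open import Data.Fin using (Fin; toℕ; fromℕ<; zero; suc)
open import Data.Fin.Properties using (toℕ-injective; toℕ<n; toℕ-fromℕ<; fromℕ<-toℕ)
open import Data.List using (List; []; _∷_; allFin)
open import Data.List.Membership.Propositional using (_∈_)
open import Data.List.Membership.Propositional.Properties using (∈-allFin)
open import Data.List.Relation.Unary.All using (All; []; _∷_; lookup)
open import Data.List.Relation.Unary.Any using (here; there)
open import Data.Maybe using (just)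
open import Data.Nat
  using (ℕ; zero; suc; pred; _+_; _*_; _⊔_; _≤_; _<_; z≤n; s≤s; s≤s⁻¹; _≡ᵇ_; _<?_)
open import Data.Nat.Properties
  using ( ≤-refl; ≤-reflexive; ≤-trans; <⇒≢; <⇒≤; <-irrefl; ≤-antisym; n≤1+n; m≤n⇒m<n∨m≡n
        ; m≤m⊔n; m≤n⊔m; m≤m+n; m≤n+m; m<n+m; +-mono-≤; +-suc; +-comm
        ; suc-injective; ≡ᵇ⇒≡; ≡⇒≡ᵇ; _≟_ )
open import Data.Nat.Tactic.RingSolver using (solve-∀)
open import Data.Product using (∃-syntax; _×_; _,_; proj₁; proj₂)
open import Data.Sum using (_⊎_; inj₁; inj₂)
open import Function using (_∘_)
open import Function.Bundles using (Equivalence)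
open import Relation.Binary.Definitions using (DecidableEquality)
open import Relation.Binary.PropositionalEquality
  using (_≡_; _≢_; refl; sym; trans; cong; cong₂; subst)
open import Relation.Nullary using (¬_; yes; no; does; contradiction)
open import Relation.Nullary.Decidable using (dec-true)
open import Defs

-- Boolean equality tests and function updates.

≡ᵇ-true⇒≡ : ∀ {m n} → (m ≡ᵇ n) ≡ true → m ≡ n
≡ᵇ-true⇒≡ {m} {n} = ≡ᵇ⇒≡ m n ∘ Equivalence.from T-≡

≡⇒≡ᵇ-true : ∀ {m n} → m ≡ n → (m ≡ᵇ n) ≡ true
≡⇒≡ᵇ-true {m} {n} = Equivalence.to T-≡ ∘ ≡⇒≡ᵇ m n

≢⇒≡ᵇ-false : ∀ {m n} → m ≢ n → (m ≡ᵇ n) ≡ false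
≢⇒≡ᵇ-false m≢n = ¬-not (m≢n ∘ ≡ᵇ-true⇒≡)

update-same : ∀ {A : Set} (f : ℕ → A) x {v} → update f x v x ≡ v
update-same f x rewrite ≡⇒≡ᵇ-true {x} refl = refl

update-other : ∀ {A : Set} (f : ℕ → A) {x v y} → y ≢ x → update f x v y ≡ f y
update-other f y≢x rewrite ≢⇒≡ᵇ-false y≢x = refl

-- The program.

stop cell next mark prior rot : Var
stop  = 2
cell  = 3
next  = 4
mark  = 5
prior = 6
rot   = 7

-- Cell n of pointers k holds 0 if rotation k of cell n is not attainable, and
-- otherwise one more than a rotation of cell n - 1 leading to it (1 if n = 0).
pointers : Rotation → Arr
pointers k = suc (toℕ k)

-- Opaque, since normalising the programs unrolled over this list is very slow.
opaque
  rotations : List Rotation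
  rotations = allFin 4

  ∈-rotations : ∀ k → k ∈ rotations
  ∈-rotations = ∈-allFin

-- The side of the unrotated piece that faces right or left after the rotation: `sameColor` reads
-- pieces only in their given position.
rightSide leftSide : Rotation → Side
rightSide zero                   = right
rightSide (suc zero)             = bottom
rightSide (suc (suc zero))       = left
rightSide (suc (suc (suc zero))) = top
leftSide zero                    = left
leftSide (suc zero)              = top
leftSide (suc (suc zero))        = right
leftSide (suc (suc (suc zero)))  = bottom

-- Loops can only be continued by a successful test, hence the flag.
until_loop_ : Test → Program → Program
until b loop p =
  stop ≔const 0 ⨾ while isZero stop loop ifTest b then (stop ≔const 1) else p

-- `cell` is still 0 here. The four stores are written out rather than generated from `rotations`,
-- so that they compute although that list is opaque.
seed : Program
seed =
  mark ≔const 1 ⨾ next ≔const 1 ⨾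
  (pointers zero at cell ≔ mark) ⨾
  (pointers (suc zero) at cell ≔ mark) ⨾
  (pointers (suc (suc zero)) at cell ≔ mark) ⨾
  (pointers (suc (suc (suc zero))) at cell ≔ mark)

-- Array names are literals, so no machine loop can range over the arrays `pointers k`. The
-- recursion unrolls the choice of `k` into code of constant size.
search : Rotation → List Rotation → Program
search l []       = mark ≔const 0
search l (k ∷ ks) =
  (prior ≔ pointers k at cell) ⨾
  ifTest isZero prior then search l ks else
  ifTest sameColor cell (rightSide k) next (leftSide l)
    then (mark ≔const suc (toℕ k)) else search l ks

fill : List Rotation → Program
fill []       = skip
fill (l ∷ ls) = search l rotations ⨾ (pointers l at next ≔ mark) ⨾ fill ls

advance : Program
advance = fill rotations ⨾ increment cell ⨾ increment next

choose : List Rotation → Program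
choose []       = skip
choose (k ∷ ks) =
  (prior ≔ pointers k at cell) ⨾
  ifTest isZero prior then choose ks else
  (verdictVar ≔const 1 ⨾ rot ≔const toℕ k ⨾ (outputArr at cell ≔ rot))

-- The array to read depends on the value of `rot`; a case distinction over the rotations replaces
-- the indirect access.
follow : List Rotation → Program
follow []       = skip
follow (k ∷ ks) =
  mark ≔const toℕ k ⨾
  ifTest isEqual rot mark then (rot ≔ pointers k at cell) else follow ks

retreat : Program
retreat =
  -- The first decrement undoes the successor in the encoding of pointers.
  follow rotations ⨾ decrement rot ⨾ decrement cell ⨾ (outputArr at cell ≔ rot)

solve : Program
solve =
  -- On the empty board the first loop would never stop, since `next` starts at 1 and only grows.
  ifTest isZero sizeVar then (verdictVar ≔const 1) else
  (seed ⨾ (until isEqual next sizeVar loop advance) ⨾ choose rotations ⨾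
   ifTest isZero verdictVar then skip else (until isZero cell loop retreat))

-- Running-time bounds.

-- Junk value 0 on loops.
cost : Program → ℕ
cost (p ⨾ q)                = cost p + cost q
cost (ifTest _ then p else q) = suc (cost p ⊔ cost q)
cost (while _ loop _)       = 0
cost _                      = 1

-- Each iteration adds two tests to the body. The 5 counts the two assignments to `stop`, the last
-- two loop tests and the successful inner test.
untilCost : Program → ℕ → ℕ
untilCost p n = n * (2 + cost p) + 5

-- One iteration of each pass per cell. The 12 consists of the overhead 5 of both loops and the two
-- tests in `solve`.
slope intercept : ℕ
slope     = (2 + cost advance) + (2 + cost retreat)
intercept = cost seed + cost (choose rotations) + 12

-- Each loop runs `m` times on `suc m` cells, so the bound exceeds the actual sum by `a + b`.
total-cost≤ : ∀ a b c d m →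
  suc (c + ((m * a + 5) + (d + suc (m * b + 5)))) ≤ (a + b) * suc m + (c + d + 12)
total-cost≤ a b c d m = ≤-trans (m≤m+n _ (a + b)) (≤-reflexive (identity a b c d m))
  where
  identity : ∀ a b c d m →
    suc (c + ((m * a + 5) + (d + suc (m * b + 5)))) + (a + b)
      ≡ (a + b) * suc m + (c + d + 12)
  identity = solve-∀

c-right-rotate : ∀ {Color} k (p : Piece Color) → c-right (rotate k p) ≡ edge (rightSide k) p
c-right-rotate zero                   p = refl
c-right-rotate (suc zero)             p = refl
c-right-rotate (suc (suc zero))       p = refl
c-right-rotate (suc (suc (suc zero))) p = refl

c-left-rotate : ∀ {Color} k (p : Piece Color) → c-left (rotate k p) ≡ edge (leftSide k) p
c-left-rotate zero                   p = refl
c-left-rotate (suc zero)             p = refl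
c-left-rotate (suc (suc zero))       p = refl
c-left-rotate (suc (suc (suc zero))) p = refl

module Correctness {Color : Set} (_≟ᶜ_ : DecidableEquality Color)
                   {M : ℕ} (P : Board Color M) where

  -- Program logic with running times.

  open Semantics _≟ᶜ_ P

  -- Weakest preconditions of loop-free programs. Loops get `⊥` and are treated by the module
  -- `Until`.
  WP : Program → (State → Set) → State → Set
  WP skip               Q s = Q s
  WP (x ≔const n)       Q s = Q (setVar x n s)
  WP (x ≔ y)            Q s = Q (setVar x (var s y) s)
  WP (increment x)      Q s = Q (setVar x (suc (var s x)) s)
  WP (decrement x)      Q s = Q (setVar x (pred (var s x)) s)
  WP (x ≔ a at y)       Q s = Q (setVar x (arr s a (var s y)) s)
  WP (a at x ≔ y)       Q s = Q (setArr a (var s x) (var s y) s)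
  WP (p ⨾ q)            Q s = WP p (WP q Q) s
  WP (ifTest b then p else q) Q s =
    (eval b s ≡ true → WP p Q s) × (eval b s ≡ false → WP q Q s)
  WP (while b loop p)   Q s = ⊥

  WP-mono : ∀ p {Q R : State → Set} {s} → (∀ {s′} → Q s′ → R s′) → WP p Q s → WP p R s
  WP-mono skip          f w = f w
  WP-mono (x ≔const n)  f w = f w
  WP-mono (x ≔ y)       f w = f w
  WP-mono (increment x) f w = f w
  WP-mono (decrement x) f w = f w
  WP-mono (x ≔ a at y)  f w = f w
  WP-mono (a at x ≔ y)  f w = f w
  WP-mono (p ⨾ q)       f w = WP-mono p (WP-mono q f) w
  WP-mono (ifTest b then p else q) f (w , v) = WP-mono p f ∘ w , WP-mono q f ∘ v

  Ensures : Program → ℕ → (State → Set) → State → Set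
  Ensures p c Q s = ∃[ s′ ] ∃[ t ] (p , s ⇓ s′ inTime t × t ≤ c × Q s′)

  -- Soundness of `WP` for the timed semantics: the execution is built along the program, and `cost`
  -- charges the dearer branch of each conditional.
  WP⇒Ensures : ∀ p {Q s} → WP p Q s → Ensures p (cost p) Q s
  WP⇒Ensures skip          w = _ , _ , ⇓skip , ≤-refl , w
  WP⇒Ensures (x ≔const n)  w = _ , _ , ⇓const , ≤-refl , w
  WP⇒Ensures (x ≔ y)       w = _ , _ , ⇓copy , ≤-refl , w
  WP⇒Ensures (increment x) w = _ , _ , ⇓increment , ≤-refl , w
  WP⇒Ensures (decrement x) w = _ , _ , ⇓decrement , ≤-refl , w
  WP⇒Ensures (x ≔ a at y)  w = _ , _ , ⇓load , ≤-refl , w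
  WP⇒Ensures (a at x ≔ y)  w = _ , _ , ⇓store , ≤-refl , w
  WP⇒Ensures (p ⨾ q)       w with WP⇒Ensures p w
  ... | _ , _ , d , t≤ , w′ with WP⇒Ensures q w′
  ... | _ , _ , e , u≤ , w″ = _ , _ , ⇓seq d e , +-mono-≤ t≤ u≤ , w″
  WP⇒Ensures (ifTest b then p else q) {s = s} (w , v) with eval b s in eq
  ... | true with WP⇒Ensures p (w refl)
  ...   | _ , _ , d , t≤ , w′ =
          _ , _ , ⇓then eq d , s≤s (≤-trans t≤ (m≤m⊔n (cost p) (cost q))) , w′
  WP⇒Ensures (ifTest b then p else q) {s = s} (w , v) | false with WP⇒Ensures q (v refl)
  ...   | _ , _ , d , t≤ , w′ =
          _ , _ , ⇓else eq d , s≤s (≤-trans t≤ (m≤n⊔m (cost p) (cost q))) , w′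

  ensures-⨾ : ∀ {p q c d Q R s} → Ensures p c Q s → (∀ {s′} → Q s′ → Ensures q d R s′) →
              Ensures (p ⨾ q) (c + d) R s
  ensures-⨾ (_ , _ , e , t≤ , x) f with f x
  ... | _ , _ , e′ , u≤ , y = _ , _ , ⇓seq e e′ , +-mono-≤ t≤ u≤ , y

  -- Inv n holds when n iterations remain.
  module Until
    (b : Test) (p : Program) (Inv : ℕ → State → Set)
    -- The loop itself writes `stop`, so the invariant has to survive that.
    (inv-stop : ∀ {n s v} → Inv n s → Inv n (setVar stop v s))
    (test-true : ∀ {s} → Inv 0 s → eval b s ≡ true)
    (test-false : ∀ {n s} → Inv (suc n) s → eval b s ≡ false)
    (body : ∀ {n s} → Inv (suc n) s →
            WP p (λ s′ → Inv n s′ × var s′ stop ≡ var s stop) s)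
    where

    private
      iterations : ∀ n {s} → Inv n s → var s stop ≡ 0 →
        Ensures (while isZero stop loop ifTest b then (stop ≔const 1) else p)
                (n * (2 + cost p) + 4) (Inv 0) s
      iterations zero inv z =
        _ , _ ,
        ⇓iterate (≡⇒≡ᵇ-true z) (⇓then (test-true inv) ⇓const) (⇓exit refl) ,
        ≤-refl , inv-stop inv
      iterations (suc n) inv z with WP⇒Ensures p (body inv)
      ... | _ , _ , d , t≤ , inv′ , z′ with iterations n inv′ (trans z′ z)
      ... | _ , _ , e , u≤ , inv″ =
        _ , _ , ⇓iterate (≡⇒≡ᵇ-true z) (⇓else (test-false inv) d) e ,
        ≤-trans (s≤s (s≤s (+-mono-≤ t≤ u≤))) (≤-reflexive (assoc (cost p) _)) , inv″
        where
        assoc : ∀ c r → 2 + (c + (r + 4)) ≡ 2 + c + r + 4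
        assoc = solve-∀

    ensures-until : ∀ {n s} → Inv n s → Ensures (until b loop p) (untilCost p n) (Inv 0) s
    ensures-until {n} inv with iterations n (inv-stop inv) refl
    ... | _ , _ , d , t≤ , inv′ =
      _ , _ , ⇓seq ⇓const d ,
      ≤-trans (s≤s t≤) (≤-reflexive (sym (+-suc (n * (2 + cost p)) 4))) , inv′

  -- Compatible rotations, paths and pointer entries.

  Compatible : ℕ → Rotation → Rotation → Set
  Compatible n k l =
    compareColors (readEdge n (rightSide k)) (readEdge (suc n) (leftSide l)) ≡ true

  readEdge-toℕ : ∀ i σ → readEdge (toℕ i) σ ≡ just (edge σ (P i))
  readEdge-toℕ i σ with toℕ i <? M
  ... | yes i<M = cong (just ∘ edge σ ∘ P) (fromℕ<-toℕ i i<M)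
  ... | no  i≮M = contradiction (toℕ<n i) i≮M

  does⇒≡ : ∀ c d → does (c ≟ᶜ d) ≡ true → c ≡ d
  does⇒≡ c d eq with yes c≡d ← c ≟ᶜ d = c≡d

  -- Both pieces exist, so neither read fails and the machine's test becomes the decision of
  -- equality of the two edges.
  compare-neighbours : ∀ {i j} σ τ → toℕ j ≡ suc (toℕ i) →
    compareColors (readEdge (toℕ i) σ) (readEdge (suc (toℕ i)) τ)
      ≡ does (edge σ (P i) ≟ᶜ edge τ (P j))
  compare-neighbours {i} {j} σ τ j≡1+i =
    cong₂ compareColors (readEdge-toℕ i σ)
      (trans (cong (λ n → readEdge n τ) (sym j≡1+i)) (readEdge-toℕ j τ))

  compatible⇒match : ∀ {i j} k l → toℕ j ≡ suc (toℕ i) → Compatible (toℕ i) k l →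
    c-right (rotate k (P i)) ≡ c-left (rotate l (P j))
  compatible⇒match {i} {j} k l j≡1+i ok =
    trans (c-right-rotate k (P i))
      (trans (does⇒≡ _ _ (trans (sym (compare-neighbours (rightSide k) (leftSide l) j≡1+i)) ok))
             (sym (c-left-rotate l (P j))))

  match⇒compatible : ∀ {i j} k l → toℕ j ≡ suc (toℕ i) →
    c-right (rotate k (P i)) ≡ c-left (rotate l (P j)) → Compatible (toℕ i) k l
  match⇒compatible {i} {j} k l j≡1+i eq =
    trans (compare-neighbours (rightSide k) (leftSide l) j≡1+i)
      (dec-true (_ ≟ᶜ _) (trans (sym (c-right-rotate k (P i))) (trans eq (c-left-rotate l (P j)))))

  -- Walks in the layered graph with the cells as layers and the rotations as vertices. On the
  -- board, a walk to layer `n` is a solved arrangement of the cells up to `n`.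
  data Path : ℕ → Rotation → Set where
    start : ∀ {k} → Path 0 k
    step  : ∀ {n k l} → Path n k → Compatible n k l → Path (suc n) l

  solution⇒path : ∀ {A} → IsSolution P A → ∀ n → n < M → ∃[ k ] Path n k
  solution⇒path {A} ((ρ , reach) , solved) n n<M = ρ (fromℕ< n<M) , path n n<M
    where
    path : ∀ n (n<M : n < M) → Path n (ρ (fromℕ< n<M))
    path zero    _     = start
    path (suc n) 1+n<M = step (path n n<M′) 
      (subst (λ m → Compatible m (ρ i) (ρ j)) (toℕ-fromℕ< n<M′)
      (match⇒compatible (ρ i) (ρ j) adjacent
        (trans (sym (cong c-right (reach i)))
          (trans (solved i j adjacent) (cong c-left (reach j))))))
      where
      n<M′ = <⇒≤ 1+n<M
      i = fromℕ< n<M′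
      j = fromℕ< 1+n<M
      adjacent : toℕ j ≡ suc (toℕ i)
      adjacent = trans (toℕ-fromℕ< 1+n<M) (cong suc (sym (toℕ-fromℕ< n<M′)))

  -- The meaning of a stored pointer: 0 comes with a refutation, any other value with a path, so
  -- testing for 0 decides attainability.
  data Entry : ℕ → Rotation → ℕ → Set where
    unreached : ∀ {n l} → ¬ Path n l → Entry n l 0
    origin    : ∀ {l} → Entry 0 l 1
    via       : ∀ {n l} k → Path n k → Compatible n k l → Entry (suc n) l (suc (toℕ k))

  entry-zero : ∀ {n k v} → Entry n k v → (v ≡ᵇ 0) ≡ true → ¬ Path n k
  entry-zero (unreached ¬p) _ = ¬p

  entry-nonzero : ∀ {n k v} → Entry n k v → (v ≡ᵇ 0) ≡ false → Path n k
  entry-nonzero origin        _ = start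
  entry-nonzero (via k p ok) _ = step p ok

  -- The outcome of searching a partial list: a miss excludes only the listed predecessors. On all
  -- rotations it becomes `unreached`, because every path to the next cell ends in a step from one
  -- of them.
  data Found (n : ℕ) (l : Rotation) (ks : List Rotation) : ℕ → Set where
    hit  : ∀ k → Path n k → Compatible n k l → Found n l ks (suc (toℕ k))
    miss : All (λ k → ¬ (Path n k × Compatible n k l)) ks → Found n l ks 0

  found-∷ : ∀ {n k l ks v} → ¬ (Path n k × Compatible n k l) →
            Found n l ks v → Found n l (k ∷ ks) v
  found-∷ ¬k (hit k p ok) = hit k p ok
  found-∷ ¬k (miss ¬ks)   = miss (¬k ∷ ¬ks)

  found⇒entry : ∀ {n l v} → Found n l rotations v → Entry (suc n) l v
  found⇒entry (hit k p ok) = via k p ok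
  found⇒entry (miss ¬ks)   =
    unreached λ { (step {k = k} p ok) → lookup ¬ks (∈-rotations k) (p , ok) }

  -- Forward pass: filling the pointer arrays.

  Entryₛ : State → ℕ → Rotation → Set
  Entryₛ s n k = Entry n k (arr s (pointers k) n)

  Filled : State → ℕ → Set
  Filled s n = ∀ k → Entryₛ s n k

  -- The variables untouched by `fill` and `follow`, bundled so that one equation serves as the
  -- frame condition.
  control : State → ℕ × ℕ × ℕ × ℕ × ℕ
  control s = var s sizeVar , var s verdictVar , var s stop , var s cell , var s next

  control-cell : ∀ {s s′} → control s′ ≡ control s → var s′ cell ≡ var s cell
  control-cell = cong λ (_ , _ , _ , c , _) → c

  control-next : ∀ {s s′} → control s′ ≡ control s → var s′ next ≡ var s next
  control-next = cong λ (_ , _ , _ , _ , n) → n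

  search-wp : ∀ l ks s → var s next ≡ suc (var s cell) → Filled s (var s cell) →
    WP (search l ks)
       (λ s′ → Found (var s cell) l ks (var s′ mark) × control s′ ≡ control s × arr s′ ≡ arr s) s
  search-wp l []       s nx fl = miss [] , refl , refl
  search-wp l (k ∷ ks) s nx fl =
    (λ z → WP-mono (search l ks) (extend (entry-zero (fl k) z ∘ proj₁)) rest) ,
    (λ nz →
      -- The machine reads piece `next`, while `Compatible` speaks of the successor of `cell`; `nx`
      -- identifies them.
      (λ eq → hit k (entry-nonzero (fl k) nz) (subst compare nx eq) , refl , refl) ,
      (λ eq → WP-mono (search l ks)
                (extend λ (_ , ok) → contradiction (trans (sym (subst test≡false nx eq)) ok) λ ())
                rest))
    where
    rest = search-wp l ks (setVar prior (arr s (pointers k) (var s cell)) s) nx fl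
    color : ℕ → Bool
    color n = compareColors (readEdge (var s cell) (rightSide k)) (readEdge n (leftSide l))
    compare test≡false : ℕ → Set
    compare    n = color n ≡ true
    test≡false n = color n ≡ false
    extend : ∀ {R : Set} {v} → ¬ (Path (var s cell) k × Compatible (var s cell) k l) →
      Found (var s cell) l ks v × R → Found (var s cell) l (k ∷ ks) v × R
    extend ¬k (f , r) = found-∷ ¬k f , r

  -- Correct entries stay correct, though possibly with another value. Thus a store of a correct
  -- entry is harmless wherever it lands.
  _⊑_ : State → State → Set
  s ⊑ s′ = ∀ n k → Entryₛ s n k → Entryₛ s′ n k

  store-⊑ : ∀ {s n l v} → Entry n l v → s ⊑ setArr (pointers l) n v s
  store-⊑ {s} {n} {l} {v} e m k e′ with toℕ k ≟ toℕ l
  ... | no k≢l rewrite ≢⇒≡ᵇ-false k≢l = e′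
  ... | yes k≡l with refl ← toℕ-injective k≡l rewrite ≡⇒≡ᵇ-true {toℕ k} refl with m ≟ n
  ...   | yes refl rewrite ≡⇒≡ᵇ-true {m} refl = e
  ...   | no m≢n rewrite ≢⇒≡ᵇ-false m≢n = e′

  store-entry : ∀ {s n l v} → Entry n l v → Entryₛ (setArr (pointers l) n v s) n l
  store-entry {s} {n} {l} e
    rewrite ≡⇒≡ᵇ-true {toℕ l} refl | ≡⇒≡ᵇ-true {n} refl = e

  fill-wp : ∀ ls s → var s next ≡ suc (var s cell) → Filled s (var s cell) →
    WP (fill ls)
       (λ s′ → All (Entryₛ s′ (var s next)) ls × s ⊑ s′ × control s′ ≡ control s) s
  fill-wp []       s nx fl = [] , (λ _ _ e → e) , refl
  fill-wp (l ∷ ls) s nx fl = WP-mono (search l rotations) store (search-wp l rotations s nx fl)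
    where
    store : ∀ {s₁} →
      Found (var s cell) l rotations (var s₁ mark) × control s₁ ≡ control s × arr s₁ ≡ arr s →
      WP (fill ls) (λ s′ → All (Entryₛ s′ (var s next)) (l ∷ ls) × s ⊑ s′ × control s′ ≡ control s)
         (setArr (pointers l) (var s₁ next) (var s₁ mark) s₁)
    store {state v₁ a₁} (f , c , refl) =
      WP-mono (fill ls)
        (λ {s′} (es , s₂⊑ , c′) →
          -- The entry for `l` is correct right after its store, and `s₂⊑` carries it through the
          -- remaining stores.
          subst (λ n → All (Entryₛ s′ n) (l ∷ ls)) nx₁ (s₂⊑ _ _ (store-entry {s = s₁} e) ∷ es) ,
          (λ m k → s₂⊑ m k ∘ s⊑ m k) , trans c′ c)
        (fill-wp ls _ (trans nx₁ (trans nx (cong suc (sym cl₁))))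
          (λ k → s⊑ _ k (subst (λ n → Entryₛ s n k) (sym cl₁) (fl k))))
      where
      s₁ = state v₁ a₁
      nx₁ = control-next {s} {s₁} c
      cl₁ = control-cell {s} {s₁} c
      e : Entry (var s₁ next) l (var s₁ mark)
      e = subst (λ n → Entry n l (var s₁ mark)) (trans (sym nx) (sym nx₁)) (found⇒entry f)
      s⊑ : s ⊑ setArr (pointers l) (var s₁ next) (var s₁ mark) s₁
      s⊑ = store-⊑ {s = s₁} e

  -- n cells remain to be processed.
  record Forward (n : ℕ) (s : State) : Set where
    field
      size-eq    : var s sizeVar ≡ M
      verdict-eq : var s verdictVar ≡ 0
      next-eq    : var s next ≡ suc (var s cell)
      remaining  : n + var s next ≡ M
      filled     : ∀ m → m ≤ var s cell → Filled s m

  advance-wp : ∀ {n s} → Forward (suc n) s →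
    WP advance (λ s′ → Forward n s′ × var s′ stop ≡ var s stop) s
  advance-wp {n} {s} fw = WP-mono (fill rotations) finish
    (fill-wp rotations s next-eq (filled _ ≤-refl))
    where
    open Forward fw
    finish : ∀ {s₁} →
      All (Entryₛ s₁ (var s next)) rotations × s ⊑ s₁ × control s₁ ≡ control s →
      WP (increment cell ⨾ increment next) (λ s′ → Forward n s′ × var s′ stop ≡ var s stop) s₁
    finish {s₁} (es , s⊑ , c) = record
      { size-eq    = trans (cong proj₁ c) size-eq
      ; verdict-eq = trans (cong (proj₁ ∘ proj₂) c) verdict-eq
      ; next-eq    = cong suc (trans nx (trans next-eq (cong suc (sym cl))))
      ; remaining  = trans (+-suc n _) (trans (cong (λ m → suc (n + m)) nx) remaining)
      ; filled     = filled′
      } , cong (proj₁ ∘ proj₂ ∘ proj₂) c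
      where
      nx = control-next {s} {s₁} c
      cl = control-cell {s} {s₁} c
      filled′ : ∀ m → m ≤ suc (var s₁ cell) → Filled s₁ m
      -- Entries up to the old `cell` persist by `s⊑`; those of the next cell were just established
      -- by `fill`.
      filled′ m m≤ k with m≤n⇒m<n∨m≡n m≤
      ... | inj₁ (s≤s m≤c) = s⊑ m k (filled m (≤-trans m≤c (≤-reflexive cl)) k)
      ... | inj₂ refl =
        subst (λ j → Entryₛ s₁ j k) (trans next-eq (cong suc (sym cl))) (lookup es (∈-rotations k))

  forward-ensures : ∀ {n s} → Forward n s →
    Ensures (until isEqual next sizeVar loop advance) (untilCost advance n) (Forward 0) s
  forward-ensures = Until.ensures-until (isEqual next sizeVar) advance Forward
    -- No field mentions `stop`, so every field transfers definitionally.
    (λ fw → record { Forward fw })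
    at-end before-end advance-wp
    where
    open Forward
    at-end : ∀ {s} → Forward 0 s → eval (isEqual next sizeVar) s ≡ true
    at-end fw = ≡⇒≡ᵇ-true (trans (remaining fw) (sym (size-eq fw)))
    before-end : ∀ {n s} → Forward (suc n) s → eval (isEqual next sizeVar) s ≡ false
    before-end {n} fw = ≢⇒≡ᵇ-false λ eq →
      <⇒≢ (m<n+m _ {suc n} (s≤s z≤n)) (trans eq (trans (size-eq fw) (sym (remaining fw))))

  -- Backward pass: following the pointers.

  Output : State → ℕ → Rotation → Set
  Output s n k = arr s outputArr n ≡ toℕ k

  record Current (n : ℕ) (s : State) : Set where
    constructor current
    field
      {rotation} : Rotation
      rot-eq     : var s rot ≡ toℕ rotation
      path       : Path n rotation
      output     : Output s n rotation

  choose-wp : ∀ {n} ks s → var s cell ≡ n → Filled s n →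
    WP (choose ks)
       (λ s′ → (var s′ verdictVar ≡ 1 × Current n s′
                 ⊎ var s′ verdictVar ≡ var s verdictVar × All (λ k → ¬ Path n k) ks)
               × var s′ cell ≡ n × (∀ k → arr s′ (pointers k) ≡ arr s (pointers k))) s
  choose-wp []       s refl fl = inj₂ (refl , []) , refl , λ _ → refl
  choose-wp (k ∷ ks) s refl fl =
    (λ z → WP-mono (choose ks) (extend (entry-zero (fl k) z)) (choose-wp ks _ refl fl)) ,
    (λ nz → inj₁ (refl , current refl (entry-nonzero (fl k) nz)
                           (update-same (arr s outputArr) (var s cell))) , refl , λ _ → refl)
    where
    extend : ∀ {A B C : Set} {n} → ¬ Path n k →
      (A ⊎ B × All (λ k → ¬ Path n k) ks) × C → (A ⊎ B × All (λ k → ¬ Path n k) (k ∷ ks)) × C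
    extend ¬p (inj₁ a , c)        = inj₁ a , c
    extend ¬p (inj₂ (b , ¬ps) , c) = inj₂ (b , ¬p ∷ ¬ps) , c

  -- The cells from `n` on are written and match their neighbours among them, and the rotation of
  -- cell `n` ends a path, so the arrangement extends to the left. Rotations are read off the output
  -- array, which determines them.
  record Backward (n : ℕ) (s : State) : Set where
    field
      verdict-eq : var s verdictVar ≡ 1
      cell-eq    : var s cell ≡ n
      filled     : ∀ m → m ≤ n → Filled s m
      position   : Current n s
      written    : ∀ m → n ≤ m → m < M → ∃[ k ] Output s m k
      linked     : ∀ m k l → n ≤ m → suc m < M →
                   Output s m k → Output s (suc m) l → Compatible m k l

  -- Membership of `l` ensures that some comparison succeeds before the list is exhausted.
  follow-wp : ∀ {l} ks s → l ∈ ks → var s rot ≡ toℕ l →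
    WP (follow ks)
       (λ s′ → var s′ rot ≡ arr s (pointers l) (var s cell)
               × control s′ ≡ control s × arr s′ ≡ arr s) s
  follow-wp {l} (k ∷ ks) s l∈ r =
    (λ eq → cong (λ k → arr s (pointers k) (var s cell))
              (toℕ-injective (trans (sym (≡ᵇ-true⇒≡ eq)) r)) , refl , refl) ,
    (λ ne → follow-wp ks _ (tail ne l∈) r)
    where
    tail : (var s rot ≡ᵇ toℕ k) ≡ false → l ∈ k ∷ ks → l ∈ ks
    tail ne (here refl) = contradiction (trans (sym (≡⇒≡ᵇ-true r)) ne) λ ()
    tail _  (there l∈)  = l∈

  backward-step : ∀ {n s s′ k l} → Backward (suc n) s → Output s (suc n) l →
    Path n k → Compatible n k l →
    var s′ verdictVar ≡ 1 → var s′ cell ≡ n → var s′ rot ≡ toℕ k →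
    arr s′ outputArr ≡ update (arr s outputArr) n (toℕ k) →
    (∀ k → arr s′ (pointers k) ≡ arr s (pointers k)) → Backward n s′
  backward-step {n} {s} {s′} {k} {l} bw ol p ok v c r o ptr = record
    { verdict-eq = v
    ; cell-eq    = c
    ; filled     = λ m m≤n j →
        subst (Entry m j) (sym (cong (λ f → f m) (ptr j))) (filled m (≤-trans m≤n (n≤1+n n)) j)
    ; position   = current r p here′
    ; written    = written′
    ; linked     = linked′
    }
    where
    open Backward bw
    here′ : Output s′ n k
    here′ = trans (cong (λ f → f n) o) (update-same (arr s outputArr) n)
    unchanged : ∀ {m} → n < m → arr s′ outputArr m ≡ arr s outputArr m
    unchanged n<m = trans (cong (λ f → f _) o) (update-other (arr s outputArr) (<⇒≢ n<m ∘ sym))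
    written′ : ∀ m → n ≤ m → m < M → ∃[ j ] Output s′ m j
    written′ m n≤m m<M with m≤n⇒m<n∨m≡n n≤m
    ... | inj₂ refl = k , here′
    ... | inj₁ n<m with written m n<m m<M
    ...   | j , oj = j , trans (unchanged n<m) oj
    linked′ : ∀ m k l → n ≤ m → suc m < M →
              Output s′ m k → Output s′ (suc m) l → Compatible m k l
    linked′ m i j n≤m m<M oi oj with m≤n⇒m<n∨m≡n n≤m
    ... | inj₁ n<m = linked m i j n<m m<M (trans (sym (unchanged n<m)) oi)
                       (trans (sym (unchanged (≤-trans n<m (n≤1+n m)))) oj)
    -- The only new link joins cells `n` and `suc n`, whose written values determine the rotations
    -- `k` and `l`.
    ... | inj₂ refl
      with refl ← toℕ-injective (trans (sym oi) here′)
         | refl ← toℕ-injective (trans (sym oj) (trans (unchanged ≤-refl) ol)) = ok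

  -- The path rules out the value 0, so the pointer names a predecessor that itself lies at the end
  -- of a path.
  entry-suc : ∀ {n l v} → Entry (suc n) l v → Path (suc n) l →
    ∃[ k ] (v ≡ suc (toℕ k) × Path n k × Compatible n k l)
  entry-suc (unreached ¬p) p = contradiction p ¬p
  entry-suc (via k q ok)   _ = k , refl , q , ok

  retreat-wp : ∀ {n s} → Backward (suc n) s →
    WP retreat (λ s′ → Backward n s′ × var s′ stop ≡ var s stop) s
  retreat-wp {n} {s} bw = WP-mono (follow rotations) finish
    (follow-wp rotations s (∈-rotations rotation) rot-eq)
    where
    open Backward bw
    open Current position
    finish : ∀ {s₁} →
      var s₁ rot ≡ arr s (pointers rotation) (var s cell)
        × control s₁ ≡ control s × arr s₁ ≡ arr s →
      WP (decrement rot ⨾ decrement cell ⨾ (outputArr at cell ≔ rot))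
         (λ s′ → Backward n s′ × var s′ stop ≡ var s stop) s₁
    finish {state v₁ a₁} (r , c , refl) with entry-suc (filled (suc n) ≤-refl rotation) path
    ... | k , eq , q , ok =
      backward-step bw output q ok (trans (cong (proj₁ ∘ proj₂) c) verdict-eq) cl rt
        (cong₂ (update (arr s outputArr)) cl rt) (λ _ → refl) ,
      cong (proj₁ ∘ proj₂ ∘ proj₂) c
      where
      cl : pred (v₁ cell) ≡ n
      cl = cong pred (trans (control-cell {s} {state v₁ a₁} c) cell-eq)
      rt : pred (v₁ rot) ≡ toℕ k
      rt = cong pred (trans r (trans (cong (arr s (pointers rotation)) cell-eq) eq))

  backward-ensures : ∀ {n s} → Backward n s →
    Ensures (until isZero cell loop retreat) (untilCost retreat n) (Backward 0) s
  backward-ensures = Until.ensures-until (isZero cell) retreat Backward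
    stop-irrelevant
    (λ bw → ≡⇒≡ᵇ-true (Backward.cell-eq bw))
    (λ bw → cong (_≡ᵇ 0) (Backward.cell-eq bw))
    retreat-wp
    where
    stop-irrelevant : ∀ {n s v} → Backward n s → Backward n (setVar stop v s)
    stop-irrelevant bw =
      record { Backward bw hiding (position) ; position = current rot-eq path output }
      where
      open Backward bw
      open Current position

  -- With `n` equal to 0 the written suffix is the whole board.
  backward⇒correct : ∀ {s} → Backward 0 s → CorrectOutput P s
  backward⇒correct {s} bw = inj₁ (ρ , (verdict-eq , out) , (ρ , λ _ → refl) , matches)
    where
    open Backward bw
    ρ : Fin M → Rotation
    ρ i = proj₁ (written (toℕ i) z≤n (toℕ<n i))
    out : ∀ i → Output s (toℕ i) (ρ i)
    out i = proj₂ (written (toℕ i) z≤n (toℕ<n i))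
    matches : Solved (rotateInPlace ρ P)
    matches i j j≡1+i = compatible⇒match (ρ i) (ρ j) j≡1+i
      (linked (toℕ i) (ρ i) (ρ j) z≤n (subst (_< M) j≡1+i (toℕ<n j)) (out i)
        (subst (λ m → Output s m (ρ j)) j≡1+i (out j)))

  last-unreachable⇒unsolvable : ∀ {n} → suc n ≡ M → (∀ k → ¬ Path n k) → Unsolvable P
  last-unreachable⇒unsolvable {n} refl ¬p (_ , sol) with solution⇒path sol n ≤-refl
  ... | k , p = ¬p k p

  -- Assembling the passes on a nonempty board.

  module Nonempty {m : ℕ} (M≡1+m : M ≡ suc m) where

    seed-wp : WP seed (Forward m) (initial M)
    seed-wp = record
      { size-eq    = refl
      ; verdict-eq = refl
      ; next-eq    = refl
      ; remaining  = trans (+-comm m 1) (sym M≡1+m)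
      -- `cell` is 0, so only the first cell is in range.
      ; filled     = λ { zero z≤n zero                   → origin
                       ; zero z≤n (suc zero)             → origin
                       ; zero z≤n (suc (suc zero))       → origin
                       ; zero z≤n (suc (suc (suc zero))) → origin }
      }

    Chosen : State → Set
    Chosen s = Backward m s ⊎ (var s verdictVar ≡ 0 × Unsolvable P)

    choose-ensures : ∀ {s} → Forward 0 s →
      Ensures (choose rotations) (cost (choose rotations)) Chosen s
    choose-ensures {s} fw = WP⇒Ensures (choose rotations)
      (WP-mono (choose rotations) classify
        (choose-wp rotations s cell≡m (filled m (≤-reflexive (sym cell≡m)))))
      where
      open Forward fw
      cell≡m : var s cell ≡ m
      cell≡m = suc-injective (trans (sym next-eq) (trans remaining M≡1+m))
      classify : ∀ {s′} →
        (var s′ verdictVar ≡ 1 × Current m s′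
          ⊎ var s′ verdictVar ≡ var s verdictVar × All (λ k → ¬ Path m k) rotations)
        × var s′ cell ≡ m × (∀ k → arr s′ (pointers k) ≡ arr s (pointers k)) → Chosen s′
      classify (inj₂ (v , ¬p) , _) = inj₂
        ( trans v verdict-eq
        , last-unreachable⇒unsolvable (sym M≡1+m) (λ k → lookup ¬p (∈-rotations k)))
      classify {s′} (inj₁ (v , cur) , c , ptr) = inj₁ record
        { verdict-eq = v
        ; cell-eq    = c
        ; filled     = λ n n≤m k → subst (Entry n k) (sym (cong (λ f → f n) (ptr k)))
                         (filled n (≤-trans n≤m (≤-reflexive (sym cell≡m))) k)
        ; position   = cur
        -- Cell `m` is the last one: `written` concerns it alone, and `linked` is vacuous.
        ; written    = λ n m≤n n<M → _ ,
            subst (λ j → Output s′ j _)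
              (≤-antisym m≤n (s≤s⁻¹ (≤-trans n<M (≤-reflexive M≡1+m)))) (Current.output cur)
        ; linked     = λ n _ _ m≤n 1+n<M _ _ → contradiction
            (≤-trans 1+n<M (≤-trans (≤-reflexive M≡1+m) (s≤s m≤n))) (<-irrefl refl)
        }

    finish-ensures : ∀ {s} → Chosen s →
      Ensures (ifTest isZero verdictVar then skip else (until isZero cell loop retreat))
              (suc (untilCost retreat m)) (CorrectOutput P) s
    finish-ensures (inj₂ (v , unsolvable)) =
      _ , _ , ⇓then (≡⇒≡ᵇ-true v) ⇓skip ,
      s≤s (≤-trans (s≤s z≤n) (m≤n+m 5 (m * (2 + cost retreat)))) , inj₂ (v , unsolvable)
    finish-ensures (inj₁ bw) with backward-ensures bw
    ... | _ , _ , d , t≤ , bw′ =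
      _ , _ , ⇓else (cong (_≡ᵇ 0) (Backward.verdict-eq bw)) d , s≤s t≤ , backward⇒correct bw′

    solve-ensures : Ensures solve (slope * suc m + intercept) (CorrectOutput P) (initial M)
    solve-ensures
      with (ensures-⨾ (WP⇒Ensures seed seed-wp) λ fw →
            ensures-⨾ (forward-ensures {m} fw) λ fw′ →
            ensures-⨾ (choose-ensures fw′) finish-ensures)
    ... | _ , _ , d , t≤ , correct =
      _ , _ , ⇓else (cong (_≡ᵇ 0) M≡1+m) d ,
      ≤-trans (s≤s t≤)
        (total-cost≤ (2 + cost advance) (2 + cost retreat) (cost seed) (cost (choose rotations)) m) ,
      correct

solve-correct : SolvesInTime solve (λ M → slope * M + intercept)
solve-correct _≟ᶜ_ zero P =
  _ , _ , ⇓then refl ⇓const ,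
  -- The empty board takes two steps, a test and an assignment, which the constant 12 in `intercept`
  -- covers.
  ≤-trans (≤-trans (m≤n+m 2 10) (m≤n+m 12 (cost seed + cost (choose rotations))))
    (m≤n+m intercept (slope * 0)) ,
  inj₁ ((λ ()) , (refl , λ ()) , ((λ ()) , λ ()) , λ ())
  where open Semantics _≟ᶜ_ P
solve-correct _≟ᶜ_ (suc m) P = Correctness.Nonempty.solve-ensures _≟ᶜ_ P refl

theorem2p1 : ∃[ p ] ∃[ a ] ∃[ b ] SolvesInTime p (λ M → a * M + b)
theorem2p1 = solve , slope , intercept , solve-correct
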